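{- The class of multi-path matroids is closed under contraction: if $M$ is a multi-path matroid and $x$ is an element of $M$, then $M/x$ is a multi-path matroid.
   Context: Transversal matroid $M[\mathcal{A}]$ of a multiset $\mathcal{A}=(A_j:j\in J)$ of subsets of a finite set $S$: independent sets are the sets $\{x_k:k\in K\}$ of $|K|$ distinct elements with $K\subseteq J$, $x_k\in A_k$; $\mathcal{A}$ is a presentation. For a cyclic permutation $\sigma$ of $S$, a $\sigma$-interval is a nonempty set $\{f,\sigma(f),\ldots,l\}$. A multi-path matroid is a transversal matroid with a presentation by an antichain (no member containing another) of $\sigma$-intervals for some cyclic permutation $\sigma$ of its ground set. -}

module Defs where

open import Data.Nat using (ℕ; zero; suc; _≤_)
open import Data.Fin using (Fin)
open import Data.Fin.Subset using (Subset; _∈_; _⊆_)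
open import Data.Fin.Permutation using (Permutation′; _⟨$⟩ʳ_)
open import Data.Bool using (Bool; true; false; if_then_else_)
open import Data.Vec using (insertAt)
open import Data.Product using (Σ; ∃; _×_; Σ-syntax; ∃-syntax)
open import Function.Bundles using (_⇔_)
open import Relation.Binary.PropositionalEquality using (_≡_; _≢_)
open import Relation.Nullary using (¬_)

IndepFamily : ℕ → Set
IndepFamily n = Subset n → Bool

iter : ∀ {n} → Permutation′ n → ℕ → Fin n → Fin n
iter σ zero    a = a
iter σ (suc k) a = σ ⟨$⟩ʳ (iter σ k a)

IsCyclic : ∀ {n} → Permutation′ n → Set
IsCyclic {n} σ = ∀ (a b : Fin n) → ∃[ k ] iter σ k a ≡ b

IsInterval : ∀ {n} → Permutation′ n → Subset n → Set
IsInterval {n} σ X =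
  Σ[ f ∈ Fin n ] Σ[ k ∈ ℕ ] (∀ (y : Fin n) → (y ∈ X) ⇔ (∃[ i ] (i ≤ k × iter σ i f ≡ y)))

TransversalIndep : ∀ {n m} → (Fin m → Subset n) → Subset n → Set
TransversalIndep {n} {m} A X =
  Σ[ K ∈ Subset m ] Σ[ φ ∈ ((k : Fin m) → k ∈ K → Fin n) ]
    ( (∀ k (p : k ∈ K) → φ k p ∈ A k)
    × (∀ k l (p : k ∈ K) (q : l ∈ K) → φ k p ≡ φ l q → k ≡ l)
    × (∀ (y : Fin n) → (y ∈ X) ⇔ (Σ[ k ∈ Fin m ] Σ[ p ∈ k ∈ K ] φ k p ≡ y)) )

IsAntichain : ∀ {n m} → (Fin m → Subset n) → Set
IsAntichain {n} {m} A = ∀ (j k : Fin m) → j ≢ k → ¬ (A j ⊆ A k)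

IsMultiPath : ∀ {n} → IndepFamily n → Set
IsMultiPath {n} M =
  Σ[ σ ∈ Permutation′ n ] Σ[ m ∈ ℕ ] Σ[ A ∈ (Fin m → Subset n) ]
    ( IsCyclic σ
    × (∀ j → IsInterval σ (A j))
    × IsAntichain A
    × (∀ (X : Subset n) → (M X ≡ true) ⇔ TransversalIndep A X) )

-- Contraction M/x. The ground set S - {x} of M/x is identified with Fin n via
-- insertion at position x (i.e. Fin.punchIn x).  For Y ⊆ S - {x}:
-- if {x} is independent, Y is independent in M/x iff Y ∪ {x} is independent in M;
-- if x is a loop, M/x = M\x, so Y is independent iff it is independent in M.
contract : ∀ {n} → IndepFamily (suc n) → Fin (suc n) → IndepFamily n
contract {n} M x Y =
  if M (insertAt (Data.Vec.replicate n false) x true)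
  then M (insertAt Y x true)
  else M (insertAt Y x false)

{-# OPTIONS --safe #-}
module Submission where

-- Cut the cyclic order at x, so that x gets the last position n. Among the arcs of the
-- presentation, sorted by their starts, the t arcs through x are consecutive, and
-- contracting x replaces them by the t - 1 unions of neighbours, without x: an arc through
-- x is the union of a part before x, shrinking along the order, and a part after x, growing
-- along the order, so a matching into the unions can be pushed back to the original arcs
-- with one of them left over for x. The unions may wrap around completely. As starts and
-- ends are still strictly increasing, the element before the start of a full arc lies in
-- every other arc and can be dropped from the full arc by an exchange; doing this for all
-- full arcs leaves an antichain.

open import Defs
open import Data.Bool using (true; false)
open import Data.Empty using (⊥-elim)
open import Data.Fin using (Fin; zero; suc; toℕ; fromℕ; fromℕ<; punchIn; punchOut)
import Data.Fin.Properties as Fin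
open import Data.Fin.Properties using (toℕ<n; toℕ-injective; toℕ-fromℕ; toℕ-fromℕ<; punchIn-punchOut; punchOut-injective; punchIn-injective; punchInᵢ≢i; pigeonhole; injective⇒≤; any?; _≟_)
open import Data.Fin.Permutation as Permutation using (Permutation′; _⟨$⟩ʳ_; _⟨$⟩ˡ_; inverseˡ; permutation; insert; _∘ₚ_; flip)
open import Data.Fin.Subset using (Subset; _∈_; _⊆_; inside; outside)
open import Data.Fin.Subset.Properties using (_∈?_)
open import Data.List using (List; []; _∷_; map; length; _++_; tabulate; filter; allFin; lookup)
open import Data.List.Properties using (++-identityʳ; map-∘; map-cong; tabulate-lookup)
open import Data.List.Membership.Propositional using () renaming (_∈_ to _∈ₗ_)
open import Data.List.Membership.Propositional.Properties using (∈-∃++; ∈-filter⁺; ∈-filter⁻; ∈-allFin; ∈-map⁺; ∈-map⁻; ∈-lookup)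
open import Data.List.Membership.Propositional.Properties.WithK using (unique∧set⇒bag)
open import Data.List.Relation.Binary.BagAndSetEquality using (∼bag⇒↭)
open import Data.List.Relation.Binary.Permutation.Propositional as Perm using (_↭_; ↭-refl; ↭-sym; ↭-trans; prep; swap; ↭⇒↭ₛ)
import Data.List.Relation.Binary.Permutation.Propositional.Properties as Perm
import Data.List.Relation.Binary.Permutation.Setoid.Properties as PermSetoid
open import Data.List.Relation.Unary.All as All using (All; []; _∷_)
import Data.List.Relation.Unary.All.Properties as All
open import Data.List.Relation.Unary.AllPairs as AllPairs using (AllPairs; []; _∷_)
import Data.List.Relation.Unary.AllPairs.Properties as AllPairs
open import Data.List.Relation.Unary.Any using (Any; here; there)
import Data.List.Relation.Unary.Sorted.TotalOrder.Properties as Sorted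
open import Data.List.Relation.Unary.Unique.Propositional using (Unique)
import Data.List.Relation.Unary.Unique.Propositional.Properties as Unique
open import Data.List.Sort using (sort; sort-↭; sort-↗)
open import Data.Nat as ℕ using (ℕ; zero; suc; pred; _+_; _*_; _≤_; _<_; _⊓_; z≤n; s≤s; _≤?_; _<?_; NonZero; >-nonZero)
open import Data.Nat.DivMod using (_%_; _/_; [m+kn]%n≡m%n; m<n⇒m%n≡m; m%n<n; m≡m%n+[m/n]*n)
open import Data.Nat.Properties hiding (_≟_)
import Data.Product as Product
open import Data.Product using (_×_; _,_; proj₁; proj₂; Σ-syntax; ∃-syntax)
open import Data.Sum using (_⊎_; inj₁; inj₂)
open import Data.Vec as Vec using ([]; _∷_; here; there; insertAt)
open import Data.Vec.Properties using ([]=⇒lookup; lookup⇒[]=; lookup∘tabulate; insertAt-lookup; insertAt-punchIn; lookup-replicate)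
open import Function using (_∘_; _⇔_; mk⇔; Equivalence)
open import Relation.Binary.Bundles using (DecTotalOrder)
import Relation.Binary.Construct.On as On
open import Relation.Binary.PropositionalEquality
open import Relation.Nullary using (¬_; yes; no; Dec; does; _×-dec_; _⊎-dec_)
open import Relation.Nullary.Decidable using (dec-true)
open Equivalence using (to; from)

-- Matchings between lists, up to permutation.

Unique-resp-↭ : {A : Set} {xs ys : List A} → xs ↭ ys → Unique xs → Unique ys
Unique-resp-↭ p = PermSetoid.Unique-resp-↭ (setoid _) (↭⇒↭ₛ p)

-- Applied with `x` the element that the current arc takes and `y` the position to be contracted:
-- `x` is matched off while `y` stays in the list.
∷-↭-∷-≢ : {A : Set} {x y : A} {xs ys : List A} → x ∷ xs ↭ y ∷ ys → x ≢ y →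
          ∃[ zs ] (xs ↭ y ∷ zs × ys ↭ x ∷ zs)
∷-↭-∷-≢ {x = x} {y} {xs} {ys} p x≢y with Perm.∈-resp-↭ (↭-sym p) (here refl)
... | here y≡x = ⊥-elim (x≢y (sym y≡x))
... | there y∈xs with ∈-∃++ y∈xs
...   | h , t , refl = h ++ t , Perm.shift y h t
                     , Perm.drop-∷ (↭-trans (↭-sym p) (↭-trans (prep x (Perm.shift y h t)) (swap x y ↭-refl)))

-- The list of elements only matters up to permutation, so that the list of sets can be
-- permuted freely.
data Matching {I E : Set} (R : I → E → Set) : List I → List E → Set where
  done : Matching R [] []
  skip : ∀ {i is es} → Matching R is es → Matching R (i ∷ is) es
  use  : ∀ {i is e es es′} → R i e → es′ ↭ e ∷ es → Matching R is es → Matching R (i ∷ is) es′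

module _ {I E : Set} {R : I → E → Set} where

  Matching-resp-elements : ∀ {is es es′} → es ↭ es′ → Matching R is es → Matching R is es′
  Matching-resp-elements p done with refl ← Perm.↭-empty-inv (↭-sym p) = done
  Matching-resp-elements p (skip m) = skip (Matching-resp-elements p m)
  Matching-resp-elements p (use r q m) = use r (↭-trans (↭-sym p) q) m

  Matching-resp-↭ : ∀ {is is′ es} → is ↭ is′ → Matching R is es → Matching R is′ es
  Matching-resp-↭ Perm.refl m = m
  Matching-resp-↭ (prep i p) (skip m) = skip (Matching-resp-↭ p m)
  Matching-resp-↭ (prep i p) (use r q m) = use r q (Matching-resp-↭ p m)
  Matching-resp-↭ (swap i j p) (skip (skip m)) = skip (skip (Matching-resp-↭ p m))
  Matching-resp-↭ (swap i j p) (skip (use r q m)) = use r q (skip (Matching-resp-↭ p m))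
  Matching-resp-↭ (swap i j p) (use r q (skip m)) = skip (use r q (Matching-resp-↭ p m))
  -- Both sets keep their elements; only the order in which these leave the list changes.
  Matching-resp-↭ (swap i j p) (use r q (use r′ q′ m)) =
    use r′ (↭-trans q (↭-trans (prep _ q′) (swap _ _ ↭-refl))) (use r ↭-refl (Matching-resp-↭ p m))
  Matching-resp-↭ (Perm.trans p q) m = Matching-resp-↭ q (Matching-resp-↭ p m)

  Matching-∈ : ∀ {is es e} → e ∈ₗ es → Matching R is es → Any (λ i → R i e) is
  Matching-∈ e∈ (skip m) = there (Matching-∈ e∈ m)
  Matching-∈ e∈ (use r p m) with Perm.∈-resp-↭ p e∈
  ... | here refl = here r
  ... | there e∈′ = there (Matching-∈ e∈′ m)

  Matching-empty : ∀ is → Matching R is []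
  Matching-empty [] = done
  Matching-empty (i ∷ is) = skip (Matching-empty is)

  Matching-singleton : ∀ {is e} → Any (λ i → R i e) is → Matching R is (e ∷ [])
  Matching-singleton (here r) = use r ↭-refl (Matching-empty _)
  Matching-singleton (there a) = skip (Matching-singleton a)

module _ {I E E′ : Set} {R : I → E′ → Set} {g : E → E′} where

  Matching-map⁺ : ∀ {is es} → Matching (λ i e → R i (g e)) is es → Matching R is (map g es)
  Matching-map⁺ done = done
  Matching-map⁺ (skip m) = skip (Matching-map⁺ m)
  Matching-map⁺ (use r p m) = use r (Perm.map⁺ g p) (Matching-map⁺ m)

  Matching-map⁻ : ∀ {is es} → Matching R is (map g es) → Matching (λ i e → R i (g e)) is es
  Matching-map⁻ {es = []} done = done
  Matching-map⁻ (skip m) = skip (Matching-map⁻ m)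
  Matching-map⁻ (use r p m) with Perm.↭-map-inv g p
  ... | _ ∷ _ , refl , p′ = use r p′ (Matching-map⁻ m)

-- Arcs of positions modulo `N`.

-- (a , b) encodes the arc of the positions a, …, b - 1 taken modulo N. Since a < N, the
-- condition a ≤ k + N is automatic, and a position k + qN < b with q > 1 gives k + N < b.
Arc : Set
Arc = ℕ × ℕ

Mem : ℕ → Arc → ℕ → Set
Mem N (a , b) k = (a ≤ k × k < b) ⊎ k + N < b

Proper : ℕ → Arc → Set
Proper N (a , b) = a < N × a < b

-- This is what incomparability becomes once arcs are sorted by start. Unlike incomparability, it
-- survives merging, where arcs may become full. If the last inequality failed, the later arc would
-- cover the earlier one on its next turn.
Before : ℕ → Arc → Arc → Set
Before N (a , b) (a′ , b′) = a < a′ × b < b′ × b′ < b + N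

-- Each inequality holds because its failure gives a containment: `b′ ≤ b` puts the second arc into
-- the first, equal starts put the first into the second, and so does `b + N ≤ b′`, after a shift by
-- one turn.
incomparable⇒Before : ∀ {N a b a′ b′} → a′ < N → a ≤ a′ →
  ¬ (∀ k → k < N → Mem N (a , b) k → Mem N (a′ , b′) k) →
  ¬ (∀ k → k < N → Mem N (a′ , b′) k → Mem N (a , b) k) →
  Before N (a , b) (a′ , b′)
incomparable⇒Before {N} {a} {b} {a′} {b′} a′<N a≤a′ i⊈j j⊈i = a<a′ , b<b′ , b′<b+N
  where
  b<b′ : b < b′
  b<b′ = ≰⇒> λ b′≤b → j⊈i λ k _ → λ where
    (inj₁ (a′≤k , k<b′)) → inj₁ (≤-trans a≤a′ a′≤k , <-≤-trans k<b′ b′≤b)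
    (inj₂ k+N<b′) → inj₂ (<-≤-trans k+N<b′ b′≤b)
  a<a′ : a < a′
  a<a′ = ≤∧≢⇒< a≤a′ λ a≡a′ → i⊈j λ k _ → λ where
    (inj₁ (a≤k , k<b)) → inj₁ (subst (_≤ k) a≡a′ a≤k , <-trans k<b b<b′)
    (inj₂ k+N<b) → inj₂ (<-trans k+N<b b<b′)
  b′<b+N : b′ < b + N
  b′<b+N = ≰⇒> λ b+N≤b′ → i⊈j λ k _ → λ where
    (inj₁ (a≤k , k<b)) → inj₂ (<-≤-trans (+-monoˡ-< N k<b) b+N≤b′)
    (inj₂ k+N<b) → inj₂ (<-trans k+N<b b<b′)

-- Removal of the last position from sorted arcs.

-- Removal of the position n from arcs modulo suc n. The arcs through n are
-- (a₁ , b₁), …, (aₜ , bₜ); they are replaced by the unions of consecutive ones.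
mergeChain : Arc → List Arc → List Arc
mergeChain i [] = []
mergeChain (a , b) ((a′ , b′) ∷ is) = (a , pred b′) ∷ mergeChain (a′ , b′) is

contractArcs : ℕ → List Arc → List Arc
contractArcs n [] = []
contractArcs n ((a , b) ∷ is) with b ≤? n
... | yes _ = (a , b) ∷ contractArcs n is
... | no _  = mergeChain (a , b) is

<pred⇒suc< : ∀ {m n} → m < pred n → suc m < n
<pred⇒suc< {n = suc n} m<n = s≤s m<n

suc<⇒<pred : ∀ {m n} → suc m < n → m < pred n
suc<⇒<pred {n = suc n} (s≤s m<n) = m<n

module _ {n : ℕ} where

  private
    N = suc n

  +-suc-< : ∀ {k b} → k + N < b → suc (k + n) < b
  +-suc-< {k} {b} = subst (_< b) (+-suc k n)

  +-suc-<⁻ : ∀ {k b} → suc (k + n) < b → k + N < b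
  +-suc-<⁻ {k} {b} = subst (_< b) (sym (+-suc k n))

  -- An arc with end at most `n` does not wrap around, so it does not notice the change of modulus.
  Mem-avoiding : ∀ {a b k} → b ≤ n → Mem N (a , b) k → Mem n (a , b) k
  Mem-avoiding b≤n (inj₁ p) = inj₁ p
  Mem-avoiding {k = k} b≤n (inj₂ k+N<b) = ⊥-elim (m+n≮n k N (m≤n⇒m≤1+n (≤-trans k+N<b b≤n)))

  Mem-avoiding⁻ : ∀ {a b k} → b ≤ n → Mem n (a , b) k → Mem N (a , b) k
  Mem-avoiding⁻ b≤n (inj₁ p) = inj₁ p
  Mem-avoiding⁻ {k = k} b≤n (inj₂ k+n<b) = ⊥-elim (m+n≮n k n (≤-trans k+n<b b≤n))

  -- The end becomes `pred b′` because a turn is now one position shorter: `k + suc n < b′` amounts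
  -- to `k + n < pred b′`.
  Mem-unionˡ : ∀ {a b a′ b′ k} → Before N (a , b) (a′ , b′) → n < b → k < n →
               Mem N (a , b) k → Mem n (a , pred b′) k
  Mem-unionˡ (_ , b<b′ , _) n<b k<n (inj₁ (a≤k , _)) =
    inj₁ (a≤k , suc<⇒<pred (≤-<-trans (≤-trans k<n (<⇒≤ n<b)) b<b′))
  Mem-unionˡ {k = k} (_ , b<b′ , _) n<b k<n (inj₂ k+N<b) =
    inj₂ (suc<⇒<pred (<-trans (+-suc-< {k} k+N<b) b<b′))

  Mem-unionʳ : ∀ {a b a′ b′ k} → Before N (a , b) (a′ , b′) → n < b → k < n →
               Mem N (a′ , b′) k → Mem n (a , pred b′) k
  Mem-unionʳ (a<a′ , b<b′ , _) n<b k<n (inj₁ (a′≤k , _)) =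
    inj₁ (≤-trans (<⇒≤ a<a′) a′≤k , suc<⇒<pred (≤-<-trans (≤-trans k<n (<⇒≤ n<b)) b<b′))
  Mem-unionʳ {k = k} _ n<b k<n (inj₂ k+N<b′) =
    inj₂ (suc<⇒<pred (+-suc-< {k} k+N<b′))

  -- Before the cut the first arc reaches furthest back, after it the second reaches furthest on.
  -- The second alternative is left as an inequality because it passes on to all later arcs, whose
  -- ends are larger.
  Mem-union⁻ : ∀ {a b b′ k} → n < b → k < n → Mem n (a , pred b′) k →
               Mem N (a , b) k ⊎ k + N < b′
  Mem-union⁻ n<b k<n (inj₁ (a≤k , _)) = inj₁ (inj₁ (a≤k , <-trans k<n n<b))
  Mem-union⁻ {k = k} n<b k<n (inj₂ k+n<) = inj₂ (+-suc-<⁻ {k} (<pred⇒suc< k+n<))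

  -- For use once the first arc has been given to `n`: every later arc hands its element to the
  -- union with its predecessor.
  chain-delete : ∀ {i is ks} → AllPairs (Before N) (i ∷ is) → n < proj₂ i → All (_< n) ks →
    Matching (Mem N) is ks → Matching (Mem n) (mergeChain i is) ks
  chain-delete s n<b ks<n done = done
  chain-delete ((i<j ∷ _) ∷ s) n<b ks<n (skip m) =
    skip (chain-delete s (<-trans n<b (proj₁ (proj₂ i<j))) ks<n m)
  chain-delete ((i<j ∷ _) ∷ s) n<b ks<n (use r p m) with Perm.All-resp-↭ p ks<n
  ... | k<n ∷ ks<n′ =
    use (Mem-unionʳ i<j n<b k<n r) p (chain-delete s (<-trans n<b (proj₁ (proj₂ i<j))) ks<n′ m)

  -- Arcs before the one matched to `n` hand their elements to the union with their successor, arcs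
  -- after it to the union with their predecessor, so one union fewer than arcs suffices.
  chain-contract : ∀ {i is ks ks′} → AllPairs (Before N) (i ∷ is) → n < proj₂ i → All (_< n) ks →
    ks′ ↭ n ∷ ks → Matching (Mem N) (i ∷ is) ks′ → Matching (Mem n) (mergeChain i is) ks
  chain-contract {is = []} s n<b ks<n p (skip done) = ⊥-elim (Perm.¬x∷xs↭[] (↭-sym p))
  chain-contract {is = []} s n<b ks<n p (use r q done)
    with refl ← Perm.↭-singleton-inv (↭-trans (↭-sym p) q) = done
  chain-contract {is = j ∷ is} ((i<j ∷ _) ∷ s) n<b ks<n p (skip m) =
    skip (chain-contract s (<-trans n<b (proj₁ (proj₂ i<j))) ks<n p m)
  chain-contract {is = j ∷ is} s₀@((i<j ∷ _) ∷ s) n<b ks<n p (use {e = k} r q m) with k ℕ.≟ n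
  ... | yes refl = chain-delete s₀ n<b ks<n (Matching-resp-elements (Perm.drop-∷ (↭-trans (↭-sym q) p)) m)
  ... | no k≢n with ∷-↭-∷-≢ (↭-trans (↭-sym q) p) k≢n
  ...   | zs , p′ , q′ with Perm.All-resp-↭ q′ ks<n
  ...     | k<n ∷ zs<n = use (Mem-unionˡ i<j n<b k<n r) q′
                             (chain-contract s (<-trans n<b (proj₁ (proj₂ i<j))) zs<n p′ m)

  -- The chain has one more arc than merged arcs, so an element y common to the whole
  -- chain can be matched in addition.
  chain-extend : ∀ {i is ks y} → AllPairs (Before N) (i ∷ is) → n < proj₂ i → All (_< n) ks →
    All (λ j → Mem N j y) (i ∷ is) → Matching (Mem n) (mergeChain i is) ks →
    Matching (Mem N) (i ∷ is) (y ∷ ks)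
  chain-extend {is = []} s n<b ks<n (r ∷ _) done = use r ↭-refl done
  chain-extend {is = j ∷ is} ((i<j ∷ _) ∷ s) n<b ks<n (_ ∷ ry) (skip m) =
    skip (chain-extend s (<-trans n<b (proj₁ (proj₂ i<j))) ks<n ry m)
  chain-extend {is = j ∷ is} ((i<j ∷ _) ∷ s@(j< ∷ _)) n<b ks<n (r ∷ ry) (use t q m)
    with Perm.All-resp-↭ q ks<n
  ... | k<n ∷ ks<n′ with Mem-union⁻ n<b k<n t
  ...   | inj₁ ti = use ti (↭-trans (prep _ q) (swap _ _ ↭-refl))
                        (chain-extend s (<-trans n<b (proj₁ (proj₂ i<j))) ks<n′ ry m)
  -- Arc `i` takes the spare element `y`, and `k` becomes the new spare one: lying in the wrapped
  -- part of `j`, it lies in all later arcs.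
  ...   | inj₂ k+N<b′ = use r (prep _ q) (chain-extend s (<-trans n<b (proj₁ (proj₂ i<j))) ks<n′
            (inj₂ k+N<b′ ∷ All.map (λ j<l → inj₂ (<-trans k+N<b′ (proj₁ (proj₂ j<l)))) j<) m)

  ¬Mem-n : ∀ {a b} → b ≤ n → ¬ Mem N (a , b) n
  ¬Mem-n b≤n (inj₁ (_ , n<b)) = <⇒≱ n<b b≤n
  ¬Mem-n b≤n (inj₂ n+N<b) = <⇒≱ (m+n≤o⇒m≤o (suc n) n+N<b) b≤n

  Mem-n : ∀ {a b} → a < N → n < b → Mem N (a , b) n
  Mem-n (s≤s a≤n) n<b = inj₁ (a≤n , n<b)

  -- For `x` a loop: no arc reaches `n`, so nothing is merged.
  contractArcs-delete : ∀ is {ks} → All (λ i → proj₂ i ≤ n) is →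
    Matching (Mem N) is ks → Matching (Mem n) (contractArcs n is) ks
  contractArcs-delete [] _ done = done
  contractArcs-delete ((a , b) ∷ is) (b≤n ∷ bs) m with b ≤? n
  ... | no b≰n = ⊥-elim (b≰n b≤n)
  contractArcs-delete ((a , b) ∷ is) (b≤n ∷ bs) (skip m) | yes _ = skip (contractArcs-delete is bs m)
  contractArcs-delete ((a , b) ∷ is) (b≤n ∷ bs) (use {e = k} r p m) | yes _ =
    use (Mem-avoiding {a} {b} {k} b≤n r) p (contractArcs-delete is bs m)

  contractArcs-delete⁻ : ∀ is {ks} → All (λ i → proj₂ i ≤ n) is →
    Matching (Mem n) (contractArcs n is) ks → Matching (Mem N) is ks
  contractArcs-delete⁻ [] _ done = done
  contractArcs-delete⁻ ((a , b) ∷ is) (b≤n ∷ bs) m with b ≤? n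
  ... | no b≰n = ⊥-elim (b≰n b≤n)
  contractArcs-delete⁻ ((a , b) ∷ is) (b≤n ∷ bs) (skip m) | yes _ = skip (contractArcs-delete⁻ is bs m)
  contractArcs-delete⁻ ((a , b) ∷ is) (b≤n ∷ bs) (use {e = k} r p m) | yes _ =
    use (Mem-avoiding⁻ {a} {b} {k} b≤n r) p (contractArcs-delete⁻ is bs m)

  -- As ends increase, the arcs ending beyond `n` form a final segment of the list. The arcs in
  -- front of it cannot take `n` and keep their elements.
  contractArcs-contract : ∀ is {ks ks′} → AllPairs (Before N) is → All (_< n) ks → ks′ ↭ n ∷ ks →
    Matching (Mem N) is ks′ → Matching (Mem n) (contractArcs n is) ks
  contractArcs-contract [] s ks<n p done = ⊥-elim (Perm.¬x∷xs↭[] (↭-sym p))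
  contractArcs-contract ((a , b) ∷ is) s ks<n p m with b ≤? n
  ... | no b≰n = chain-contract s (≰⇒> b≰n) ks<n p m
  contractArcs-contract ((a , b) ∷ is) (_ ∷ s) ks<n p (skip m) | yes _ =
    skip (contractArcs-contract is s ks<n p m)
  contractArcs-contract ((a , b) ∷ is) (_ ∷ s) ks<n p (use {e = k} r q m) | yes b≤n
    with ∷-↭-∷-≢ (↭-trans (↭-sym q) p) (λ { refl → ¬Mem-n {a} b≤n r })
  ... | zs , p′ , q′ with Perm.All-resp-↭ q′ ks<n
  ...   | _ ∷ zs<n = use (Mem-avoiding {a} {b} {k} b≤n r) q′ (contractArcs-contract is s zs<n p′ m)

  -- The common element in `chain-extend` is `n` itself. That some arc contains `n` guarantees that
  -- the chain is reached before the list ends.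
  contractArcs-contract⁻ : ∀ is {ks} → AllPairs (Before N) is → All (Proper N) is → All (_< n) ks →
    Any (λ i → Mem N i n) is → Matching (Mem n) (contractArcs n is) ks → Matching (Mem N) is (n ∷ ks)
  contractArcs-contract⁻ ((a , b) ∷ is) (i< ∷ s) pr ks<n n∈ m with b ≤? n
  ... | no b≰n = chain-extend (i< ∷ s) n<b ks<n
      (allMem pr (n<b ∷ All.map (λ i<j → <-trans n<b (proj₁ (proj₂ i<j))) i<)) m
    where
    n<b : n < b
    n<b = ≰⇒> b≰n
    allMem : ∀ {is} → All (Proper N) is → All (λ i → n < proj₂ i) is → All (λ i → Mem N i n) is
    allMem [] [] = []
    allMem ((a<N , _) ∷ ps) (n<b ∷ bs) = Mem-n a<N n<b ∷ allMem ps bs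
  contractArcs-contract⁻ ((a , b) ∷ is) s pr ks<n (here r) m | yes b≤n = ⊥-elim (¬Mem-n {a} b≤n r)
  contractArcs-contract⁻ ((a , b) ∷ is) (_ ∷ s) (_ ∷ pr) ks<n (there n∈) (skip m) | yes _ =
    skip (contractArcs-contract⁻ is s pr ks<n n∈ m)
  contractArcs-contract⁻ ((a , b) ∷ is) (_ ∷ s) (_ ∷ pr) ks<n (there n∈) (use {e = k} r q m) | yes b≤n
    with Perm.All-resp-↭ q ks<n
  ... | _ ∷ ks<n′ = use (Mem-avoiding⁻ {a} {b} {k} b≤n r) (↭-trans (prep _ q) (swap _ _ ↭-refl))
                        (contractArcs-contract⁻ is s pr ks<n′ n∈ m)

  -- A single induction for all invariants of merged arcs: it serves for `Proper` and for being
  -- `Before` a fixed arc.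
  mergeChain-All : ∀ {P Q : Arc → Set} → (∀ {a b a′ b′} → n < b → Before N (a , b) (a′ , b′) →
      P (a , b) → P (a′ , b′) → Q (a , pred b′)) →
    ∀ {i is} → AllPairs (Before N) (i ∷ is) → n < proj₂ i → All P (i ∷ is) → All Q (mergeChain i is)
  mergeChain-All step {is = []} _ _ _ = []
  mergeChain-All step {is = j ∷ is} ((i<j ∷ _) ∷ s) n<b (pi ∷ ps@(pj ∷ _)) =
    step n<b i<j pi pj ∷ mergeChain-All step s (<-trans n<b (proj₁ (proj₂ i<j))) ps

  contractArcs-All : ∀ {P Q : Arc → Set} → (∀ {a b} → b ≤ n → P (a , b) → Q (a , b)) →
    (∀ {a b a′ b′} → n < b → Before N (a , b) (a′ , b′) → P (a , b) → P (a′ , b′) → Q (a , pred b′)) →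
    ∀ is → AllPairs (Before N) is → All P is → All Q (contractArcs n is)
  contractArcs-All keep step [] _ _ = []
  contractArcs-All keep step ((a , b) ∷ is) (i< ∷ s) (p ∷ ps) with b ≤? n
  ... | yes b≤n = keep b≤n p ∷ contractArcs-All keep step is s ps
  ... | no b≰n = mergeChain-All step (i< ∷ s) (≰⇒> b≰n) (p ∷ ps)

  -- The start of a union is below `n` because its second arc starts strictly later, and at `n` at
  -- the latest. An arc starting at `n` can only be the last of the chain, so it starts no union.
  contractArcs-Proper : ∀ is → AllPairs (Before N) is → All (Proper N) is →
    All (Proper n) (contractArcs n is)
  contractArcs-Proper = contractArcs-All
    (λ b≤n (_ , a<b) → <-≤-trans a<b b≤n , a<b)
    (λ { n<b (a<a′ , b<b′ , _) (_ , a<b) (s≤s a′≤n , _) →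
         <-≤-trans a<a′ a′≤n , suc<⇒<pred (≤-<-trans a<b b<b′) })

  -- Neighbouring unions share an arc, hence the weak `b′ ≤ d`. For the wrap-around bound, the later
  -- end and the turn both shrink by one, and `b ≤ pred b′`.
  Before-merge-merge : ∀ {a b a′ b′ c d c′ d′} → Before N (a , b) (a′ , b′) → b′ ≤ d →
    Before N (a , b) (c , d) → Before N (a , b) (c′ , d′) → Before N (c , d) (c′ , d′) →
    Before n (a , pred b′) (c , pred d′)
  Before-merge-merge {b = b} {b′ = suc b′} {d′ = suc d′}
    (_ , s≤s b≤b′ , _) b′<d (a<c , _) (_ , _ , d′<b+N) (_ , s≤s d≤d′ , _) =
    a<c , ≤-trans b′<d d≤d′ , <-≤-trans (≤-pred (subst (suc d′ <_) (+-suc b n) d′<b+N)) (+-monoˡ-≤ n b≤b′)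

  Before-keep-keep : ∀ {a b a′ b′} → a < b → b′ ≤ n → Before N (a , b) (a′ , b′) → Before n (a , b) (a′ , b′)
  Before-keep-keep {b = suc b} a<b b′≤n (a<a′ , b<b′ , _) = a<a′ , b<b′ , s≤s (≤-trans b′≤n (m≤n+m n b))

  Before-keep-merge : ∀ {a b c d c′ d′} → b ≤ n → n < d → Before N (a , b) (c , d) →
    Before N (a , b) (c′ , d′) → Before N (c , d) (c′ , d′) → Before n (a , b) (c , pred d′)
  Before-keep-merge {b = b} {d′ = suc d′} b≤n n<d (a<c , _) (_ , _ , d′<b+N) (_ , s≤s d≤d′ , _) =
    a<c , ≤-trans (≤-<-trans b≤n n<d) d≤d′ , ≤-pred (subst (suc d′ <_) (+-suc b n) d′<b+N)

  mergeChain-Before : ∀ {i is} → AllPairs (Before N) (i ∷ is) → n < proj₂ i →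
    AllPairs (Before n) (mergeChain i is)
  mergeChain-Before {is = []} _ _ = []
  mergeChain-Before {i} {is = j ∷ is} ((i<j ∷ i<) ∷ s@(j< ∷ _)) n<b =
    mergeChain-All {P = λ l → Before N i l × proj₂ j ≤ proj₂ l}
      (λ _ kl (ik , j≤k) (il , _) → Before-merge-merge i<j j≤k ik il kl) s n<b′
      (All.zip (i<j ∷ i< , ≤-refl ∷ All.map (λ j<l → <⇒≤ (proj₁ (proj₂ j<l))) j<))
    ∷ mergeChain-Before s n<b′
    where
    n<b′ = <-trans n<b (proj₁ (proj₂ i<j))

  contractArcs-Before : ∀ is → AllPairs (Before N) is → All (Proper N) is →
    AllPairs (Before n) (contractArcs n is)
  contractArcs-Before [] _ _ = []
  contractArcs-Before ((a , b) ∷ is) (i< ∷ s) ((_ , a<b) ∷ pr) with b ≤? n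
  ... | yes b≤n = contractArcs-All (Before-keep-keep a<b)
                    (λ n<d kl ik il → Before-keep-merge b≤n n<d ik il kl) is s i<
                  ∷ contractArcs-Before is s pr
  ... | no b≰n = mergeChain-Before (i< ∷ s) (≰⇒> b≰n)

-- Truncation of full arcs.

-- An arc is full if `a + n ≤ b`; for positive `n`, `a + pred n` is the largest end of an arc from
-- `a` that is not.
truncate : ℕ → Arc → Arc
truncate n (a , b) = a , b ⊓ (a + pred n)

module _ {n : ℕ} where

  -- k is the position just before a modulo n, the one lost when a full arc from a is truncated.
  Missed : ℕ → ℕ → Set
  Missed a k = suc k ≡ a ⊎ suc k ≡ a + n

  Missed-unique : ∀ {a k l} → k < n → l < n → Missed a k → Missed a l → k ≡ l
  Missed-unique _ _ (inj₁ p) (inj₁ q) = suc-injective (trans p (sym q))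
  Missed-unique _ _ (inj₂ p) (inj₂ q) = suc-injective (trans p (sym q))
  Missed-unique {k = k} _ l<n (inj₁ refl) (inj₂ q) = ⊥-elim (m+n≮n k n (subst (_< n) (suc-injective q) l<n))
  Missed-unique {l = l} k<n _ (inj₂ p) (inj₁ refl) = ⊥-elim (m+n≮n l n (subst (_< n) (suc-injective p) k<n))

Mem-truncate-full : ∀ {n a b k} → a + n ≤ b → k < n → Mem n (truncate n (a , b)) k ⊎ Missed {n} a k
Mem-truncate-full {suc n} {a} {b} {k} a+n≤b k<n
  rewrite m≥n⇒m⊓n≡n (≤-trans (+-monoʳ-≤ a (n≤1+n n)) a+n≤b) with a ≤? k | suc k ≤? a + n
... | yes a≤k | yes k<a+n = inj₁ (inj₁ (a≤k , k<a+n))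
... | yes a≤k | no k≮a+n =
  inj₂ (inj₂ (≤-antisym (≤-trans k<n (m≤n+m (suc n) a)) (subst (_≤ suc k) (sym (+-suc a n)) (≰⇒> k≮a+n))))
... | no a≰k | _ with m≤n⇒m<n∨m≡n (≰⇒> a≰k)
...   | inj₁ 1+k<a = inj₁ (inj₂ (subst (_< a + n) (sym (+-suc k n)) (+-monoˡ-< n 1+k<a)))
...   | inj₂ 1+k≡a = inj₂ (inj₁ 1+k≡a)

Mem-truncate : ∀ {n a b k} → k < n → Mem n (a , b) k →
  Mem n (truncate n (a , b)) k ⊎ (a + n ≤ b × Missed {n} a k)
Mem-truncate {suc n} {a} {b} {k} k<n r with b ≤? a + n
... | yes b≤a+n rewrite m≤n⇒m⊓n≡m b≤a+n = inj₁ r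
... | no b≰a+n with subst (_≤ b) (sym (+-suc a n)) (≰⇒> b≰a+n)
...   | full with Mem-truncate-full {suc n} {a} {b} full k<n
...     | inj₁ t = inj₁ t
...     | inj₂ e = inj₂ (full , e)

Mem-truncate⁻ : ∀ {n a b k} → Mem n (truncate n (a , b)) k → Mem n (a , b) k
Mem-truncate⁻ {n} {a} {b} (inj₁ (a≤k , k<)) = inj₁ (a≤k , <-≤-trans k< (m⊓n≤m b _))
Mem-truncate⁻ {n} {a} {b} (inj₂ k+n<) = inj₂ (<-≤-trans k+n< (m⊓n≤m b _))

-- The end `b′` exceeds `a + n`, so the wrapped part of the later arc passes the position before
-- `a`. If that position is `n - 1`, as for `a = 0`, it is at or after `a′` already.
missed∈later : ∀ {n a b a′ b′ k} → a + n ≤ b → Before n (a , b) (a′ , b′) → a′ < n →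
  Missed {n} a k → Mem n (a′ , b′) k
missed∈later {n} full (_ , b<b′ , _) _ (inj₁ refl) = inj₂ (≤-<-trans (≤-trans (n≤1+n _) full) b<b′)
missed∈later {n} {a} full (_ , b<b′ , _) a′<n (inj₂ e) =
  inj₁ (≤-pred (≤-trans a′<n (subst (n ≤_) (sym e) (m≤n+m n a))) ,
        ≤-trans (≤-trans (≤-reflexive e) full) (<⇒≤ b<b′))

-- From `a + n ≤ b < b′ + n` follows `a < b′`, so the earlier arc covers the position before `a`,
-- and does so within its truncation.
missed∈earlier : ∀ {n a b a′ b′ k} → a + n ≤ b → Before n (a′ , b′) (a , b) → a < n → k < n →
  Missed {n} a k → Mem n (truncate n (a′ , b′)) k
missed∈earlier {suc n} {a′ = a′} {b′} {k} full (s≤s a′≤k , _ , b<b′+n) (s≤s k<n) _ (inj₁ refl) =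
  inj₁ (a′≤k , ⊓-glb (<⇒≤ (+-cancelʳ-< (suc n) _ _ (≤-<-trans full b<b′+n))) (≤-trans k<n (m≤n+m n a′)))
missed∈earlier {n} {suc a} _ _ _ k<n (inj₂ e) = ⊥-elim (m+n≮n a n (subst (_< n) (suc-injective e) k<n))

-- If the full arc i uses its missed position, that position can be moved to the other arc j,
-- and i takes over whatever j was matched to.
truncate-head : ∀ {n i j is ks} → All (_< n) ks → Unique ks →
  (proj₁ i + n ≤ proj₂ i → ∀ {k} → k < n → Missed {n} (proj₁ i) k → Mem n j k) →
  Matching (Mem n) (i ∷ j ∷ is) ks → Matching (Mem n) (truncate n i ∷ j ∷ is) ks
truncate-head _ _ _ (skip m) = skip m
truncate-head {n} {a , b} ks<n uks other (use {e = k} r p m) with Perm.All-resp-↭ p ks<n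
... | k<n ∷ ks<n′ with Mem-truncate {n} {a} {b} k<n r
...   | inj₁ t = use t p m
...   | inj₂ (full , missed) with m
...     | skip m′ = skip (use (other full k<n missed) p m′)
...     | use {e = l} r′ p′ m′ with Perm.All-resp-↭ p′ ks<n′
...       | l<n ∷ _ with Mem-truncate-full {n} {a} {b} full l<n
...         | inj₁ t = use t (↭-trans p (↭-trans (prep _ p′) (swap _ _ ↭-refl))) (use (other full k<n missed) ↭-refl m′)
...         | inj₂ missed′ with Unique-resp-↭ (↭-trans p (prep _ p′)) uks
...           | (k≢l ∷ _) ∷ _ = ⊥-elim (k≢l (Missed-unique k<n l<n missed missed′))

-- The arcs are truncated in order; `ds` holds those already truncated, the latest first. The
-- partner for the exchange is the next arc or, for the last arc, its truncated predecessor at the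
-- head of `ds`; the bound on the lengths ensures that one exists.
truncate-rec : ∀ {n} is ds {ks} → 2 ≤ length is + length ds → AllPairs (Before n) is → All (Proper n) is →
  All (λ d → All (Before n d) is) ds → All (_< n) ks → Unique ks →
  Matching (Mem n) (is ++ map (truncate n) ds) ks →
  Matching (Mem n) (map (truncate n) is ++ map (truncate n) ds) ks
truncate-rec [] ds _ _ _ _ _ _ m = m
truncate-rec {n} (i ∷ is) ds {ks} two (i< ∷ s) (pi ∷ pr) ds< ks<n uks m =
  Matching-resp-↭ (Perm.shift _ (map (truncate n) is) _)
    (truncate-rec is (i ∷ ds) (subst (2 ≤_) (sym (+-suc (length is) (length ds))) two) s pr
      (i< ∷ All.map All.tail ds<) ks<n uks
      (Matching-resp-↭ (↭-sym (Perm.shift _ is _)) (first is ds two i< pr ds< m)))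
  where
  first : ∀ is ds → 2 ≤ suc (length is) + length ds → All (Before n i) is → All (Proper n) is →
    All (λ d → All (Before n d) (i ∷ is)) ds →
    Matching (Mem n) (i ∷ is ++ map (truncate n) ds) ks →
    Matching (Mem n) (truncate n i ∷ is ++ map (truncate n) ds) ks
  first (j ∷ is) ds _ (i<j ∷ _) ((a′<n , _) ∷ _) _ m =
    truncate-head ks<n uks (λ full _ e → missed∈later full i<j a′<n e) m
  first [] (d ∷ ds) _ _ _ ((d<i ∷ _) ∷ _) m =
    truncate-head ks<n uks (λ full k<n e → missed∈earlier full d<i (proj₁ pi) k<n e) m
  first [] [] (s≤s ()) _ _ _ _

-- Antichains of arcs.

AllPairs-All : {A : Set} {P : A → Set} {R S : A → A → Set} → (∀ {x y} → P x → P y → R x y → S x y) →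
  ∀ {xs} → All P xs → AllPairs R xs → AllPairs S xs
AllPairs-All h [] [] = []
AllPairs-All h (p ∷ ps) (rs ∷ s) = All.zipWith (λ (q , r) → h p q r) (ps , rs) ∷ AllPairs-All h ps s

AllPairs-lookup : {A : Set} {R : A → A → Set} → (∀ {x y} → R x y → R y x) →
  ∀ {xs} → AllPairs R xs → ∀ i j → i ≢ j → R (lookup xs i) (lookup xs j)
AllPairs-lookup sm (rs ∷ s) zero zero i≢j = ⊥-elim (i≢j refl)
AllPairs-lookup sm (rs ∷ s) zero (suc j) i≢j = All.lookup rs (∈-lookup j)
AllPairs-lookup sm (rs ∷ s) (suc i) zero i≢j = sm (All.lookup rs (∈-lookup i))
AllPairs-lookup sm (rs ∷ s) (suc i) (suc j) i≢j = AllPairs-lookup sm s i j (i≢j ∘ cong suc)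

Contained : ℕ → Arc → Arc → Set
Contained n i j = ∀ k → k < n → Mem n i k → Mem n j k

Incomparable : ℕ → Arc → Arc → Set
Incomparable n i j = ¬ Contained n i j × ¬ Contained n j i

-- Against the first containment speaks the position before the start of the second arc, against the
-- second one the position just past the end of the first arc. If the second arc starts beyond that
-- end, the last position of the first arc and the start of the second serve instead.
Before⇒Incomparable : ∀ {n a b a′ b′} → Proper n (a , b) → Proper n (a′ , b′) →
  b ≤ a + pred n → b′ ≤ a′ + pred n → Before n (a , b) (a′ , b′) → Incomparable n (a , b) (a′ , b′)
Before⇒Incomparable {suc n} {a} {suc b} {suc a′} {b′} (a<n , s≤s a≤b) (a′<n , a′<b′) b≤ b′≤
  (s≤s a≤a′ , b<b′ , b′<b+n) = i⊈j , j⊈i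
  where
  i⊈j : ¬ Contained (suc n) (a , suc b) (suc a′ , b′)
  i⊈j c with a′ ≤? b
  ... | yes a′≤b with c a′ (<⇒≤ a′<n) (inj₁ (a≤a′ , s≤s a′≤b))
  ...   | inj₁ (a′<a′ , _) = 1+n≰n a′<a′
  ...   | inj₂ a′+n<b′ = <⇒≱ a′+n<b′ (subst (b′ ≤_) (sym (+-suc a′ n)) b′≤)
  i⊈j c | no a′≰b with c b (<-trans (≰⇒> a′≰b) (<⇒≤ a′<n)) (inj₁ (a≤b , ≤-refl))
  ...   | inj₁ (a′<b , _) = a′≰b (<⇒≤ a′<b)
  ...   | inj₂ b+n<b′ = 1+n≰n (≤-trans b+n<b′ (≤-pred b′<b+n))
  j⊈i : ¬ Contained (suc n) (suc a′ , b′) (a , suc b)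
  j⊈i c with suc a′ ≤? suc b
  ... | no a′≰b with c (suc a′) a′<n (inj₁ (≤-refl , a′<b′))
  ...   | inj₁ (_ , a′<b) = a′≰b (<⇒≤ a′<b)
  ...   | inj₂ a′+n<b = a′≰b (≤-trans (m≤m+n (suc a′) (suc n)) (<⇒≤ a′+n<b))
  j⊈i c | yes a′≤b with suc b <? suc n
  ... | yes b<n with c (suc b) b<n (inj₁ (a′≤b , b<b′))
  ...   | inj₁ (_ , b<b) = 1+n≰n b<b
  ...   | inj₂ b+n<b = m+n≮m (suc b) (suc n) b+n<b
  -- The position past the end of the first arc is beyond the cut, so `k` is that position less one
  -- turn.
  j⊈i c | yes a′≤b | no b≮n with m≤n⇒∃[o]m+o≡n (≮⇒≥ b≮n)
  ... | k , n+k≡b with c k (≤-<-trans k≤a a<n) (inj₂ (subst (_< b′) (trans (sym n+k≡b) (+-comm (suc n) k)) b<b′))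
    where
    k≤a : k ≤ a
    k≤a = +-cancelˡ-≤ n _ _
      (≤-trans (≤-trans (n≤1+n _) (≤-reflexive n+k≡b)) (subst (suc b ≤_) (+-comm a n) b≤))
  ...   | inj₁ (a≤k , _) = 1+n≰n (begin
    suc (a + n) ≡⟨ cong suc (+-comm a n) ⟩
    suc n + a   ≤⟨ +-monoʳ-≤ (suc n) a≤k ⟩
    suc n + k   ≡⟨ n+k≡b ⟩
    suc b       ≤⟨ b≤ ⟩
    a + n       ∎)
    where open ≤-Reasoning
  ...   | inj₂ k+n<b = <-irrefl (trans (+-comm k (suc n)) n+k≡b) k+n<b

-- The caps `a + pred n` increase with the starts and differ by less than a turn, so taking minima
-- with them preserves all three inequalities.
truncate-Before : ∀ {n i j} → proj₁ j < n → Before n i j → Before n (truncate n i) (truncate n j)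
truncate-Before {n} {a , b} {a′ , b′} a′<n (a<a′ , b<b′ , b′<b+n) =
  a<a′ , ⊓-mono-< b<b′ (+-monoˡ-< (pred n) a<a′) ,
  subst (b′ ⊓ (a′ + pred n) <_) (sym (+-distribʳ-⊓ n b (a + pred n)))
    (⊓-mono-< b′<b+n (<-≤-trans (+-monoˡ-< (pred n) a′<n)
      (≤-trans (≤-reflexive (+-comm n (pred n))) (+-monoˡ-≤ n (m≤n+m (pred n) a)))))

truncate-Proper : ∀ {n i} → 2 ≤ n → Proper n i → Proper n (truncate n i)
truncate-Proper {suc n} {a , b} (s≤s 1≤n) (a<n , a<b) =
  a<n , ⊓-glb a<b (subst (_≤ a + n) (+-comm a 1) (+-monoʳ-≤ a 1≤n))

-- Only an antichain with a single member may contain a full arc.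
shorten : ℕ → List Arc → List Arc
shorten n is@(_ ∷ _ ∷ _) = map (truncate n) is
shorten n is = is

-- Two distinct starts below `n` force this; it keeps arcs cut to length `pred n` nonempty.
two≤n : ∀ {n i j} → Proper n j → Before n i j → 2 ≤ n
two≤n (a′<n , _) (a<a′ , _) = ≤-trans (s≤s (≤-trans (s≤s z≤n) a<a′)) a′<n

shorten-Proper : ∀ {n is} → All (Proper n) is → AllPairs (Before n) is → All (Proper n) (shorten n is)
shorten-Proper [] _ = []
shorten-Proper (p ∷ []) _ = p ∷ []
shorten-Proper ps@(_ ∷ p ∷ _) ((i<j ∷ _) ∷ _) = All.map⁺ (All.map (truncate-Proper (two≤n p i<j)) ps)

shorten-Incomparable : ∀ {n is} → All (Proper n) is → AllPairs (Before n) is →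
  AllPairs (Incomparable n) (shorten n is)
shorten-Incomparable [] _ = []
shorten-Incomparable (p ∷ []) _ = [] ∷ []
shorten-Incomparable {n} {is = i ∷ j ∷ is} ps@(_ ∷ p ∷ _) s@((i<j ∷ _) ∷ _) =
  AllPairs.map⁺ (AllPairs-All incomparable ps s)
  where
  2≤n = two≤n p i<j
  incomparable : ∀ {i j} → Proper n i → Proper n j → Before n i j → Incomparable n (truncate n i) (truncate n j)
  incomparable {a , b} {a′ , b′} pi pj i<j =
    Before⇒Incomparable (truncate-Proper 2≤n pi) (truncate-Proper 2≤n pj)
      (m⊓n≤n b _) (m⊓n≤n b′ _) (truncate-Before (proj₁ pj) i<j)

shorten-matching : ∀ {n is ks} → All (Proper n) is → AllPairs (Before n) is → All (_< n) ks → Unique ks →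
  Matching (Mem n) is ks → Matching (Mem n) (shorten n is) ks
shorten-matching {is = []} _ _ _ _ m = m
shorten-matching {is = _ ∷ []} _ _ _ _ m = m
shorten-matching {n} {is = is@(_ ∷ _ ∷ _)} {ks} ps s ks<n uks m =
  subst (λ js → Matching (Mem n) js ks) (++-identityʳ _)
    (truncate-rec is [] (s≤s (s≤s z≤n)) s ps [] ks<n uks (subst (λ js → Matching (Mem n) js ks) (sym (++-identityʳ is)) m))

truncate-matching⁻ : ∀ {n} is {ks} → Matching (Mem n) (map (truncate n) is) ks → Matching (Mem n) is ks
truncate-matching⁻ [] done = done
truncate-matching⁻ (i ∷ is) (skip m) = skip (truncate-matching⁻ is m)
truncate-matching⁻ ((a , b) ∷ is) (use r p m) = use (Mem-truncate⁻ {a = a} {b} r) p (truncate-matching⁻ is m)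

shorten-matching⁻ : ∀ {n} is {ks} → Matching (Mem n) (shorten n is) ks → Matching (Mem n) is ks
shorten-matching⁻ [] m = m
shorten-matching⁻ (_ ∷ []) m = m
shorten-matching⁻ is@(_ ∷ _ ∷ _) m = truncate-matching⁻ is m

byStart : DecTotalOrder _ _ _
byStart = On.decTotalOrder {B = Arc} ≤-decTotalOrder proj₁

sort-Before : ∀ {n} is → All (Proper n) is → AllPairs (Incomparable n) is → AllPairs (Before n) (sort byStart is)
sort-Before {n} is ps s = AllPairs-All
  (λ { (a<n , _) (a′<n , _) (a≤a′ , i⊈j , j⊈i) → incomparable⇒Before a′<n a≤a′ i⊈j j⊈i })
  (Perm.All-resp-↭ (↭-sym (sort-↭ byStart is)) ps)
  (AllPairs.zip (Sorted.Sorted⇒AllPairs (DecTotalOrder.totalOrder byStart) (sort-↗ byStart is)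
    , PermSetoid.AllPairs-resp-↭ (setoid Arc) Product.swap ((λ { refl r → r }) , (λ { refl r → r }))
        (↭⇒↭ₛ (↭-sym (sort-↭ byStart is))) s))

-- Positions along a cyclic permutation.

-- A numbering of the ground set along `σ`, with the cycle cut open between positions `N - 1` and
-- `0`.
record Positions {N : ℕ} (σ : Permutation′ N) : Set where
  field
    pos : Fin N → ℕ
    pos<N : ∀ y → pos y < N
    pos-injective : ∀ {y z} → pos y ≡ pos z → y ≡ z
    pos-surjective : ∀ {k} → k < N → ∃[ y ] pos y ≡ k
    pos-σ : ∀ y → pos (σ ⟨$⟩ʳ y) ≡ suc (pos y) ⊎ (suc (pos y) ≡ N × pos (σ ⟨$⟩ʳ y) ≡ 0)

remainder-unique : ∀ {N r s} p q → r < N → s < N → r + p * N ≡ s + q * N → r ≡ s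
remainder-unique {N} {r} {s} p q r<N s<N eq = begin
  r               ≡⟨ m<n⇒m%n≡m r<N ⟨
  r % N           ≡⟨ [m+kn]%n≡m%n r p N ⟨
  (r + p * N) % N ≡⟨ cong (_% N) eq ⟩
  (s + q * N) % N ≡⟨ [m+kn]%n≡m%n s q N ⟩
  s % N           ≡⟨ m<n⇒m%n≡m s<N ⟩
  s               ∎
  where
  open ≡-Reasoning
  instance
    nz : NonZero N
    nz = >-nonZero (≤-<-trans z≤n r<N)

module _ {N : ℕ} {σ : Permutation′ N} (P : Positions σ) where
  open Positions P

  -- The witness `q` counts how often the walk crosses the cut.
  pos-iter : ∀ i y → ∃[ q ] pos (iter σ i y) + q * N ≡ pos y + i
  pos-iter zero y = 0 , refl
  pos-iter (suc i) y with pos-iter i y | pos-σ (iter σ i y)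
  ... | q , eq | inj₁ e = q , (begin
    pos (iter σ (suc i) y) + q * N ≡⟨ cong (_+ q * N) e ⟩
    suc (pos (iter σ i y) + q * N) ≡⟨ cong suc eq ⟩
    suc (pos y + i)                ≡⟨ +-suc (pos y) i ⟨
    pos y + suc i                  ∎)
    where open ≡-Reasoning
  ... | q , eq | inj₂ (e , e₀) = suc q , (begin
    pos (iter σ (suc i) y) + suc q * N ≡⟨ cong (_+ suc q * N) e₀ ⟩
    N + q * N                          ≡⟨ cong (_+ q * N) e ⟨
    suc (pos (iter σ i y) + q * N)     ≡⟨ cong suc eq ⟩
    suc (pos y + i)                    ≡⟨ +-suc (pos y) i ⟨
    pos y + suc i                      ∎)
    where open ≡-Reasoning

  iter-reaches : ∀ i p {y z} → pos y + i ≡ pos z + p * N → iter σ i y ≡ z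
  iter-reaches i p {y} {z} e with pos-iter i y
  ... | q , eq = pos-injective (remainder-unique q p (pos<N _) (pos<N z) (trans eq e))

  Positions⇒IsCyclic : IsCyclic σ
  -- The target is taken one turn later, so that its distance from `pos y` is a natural number.
  Positions⇒IsCyclic y z with m≤n⇒∃[o]m+o≡n (≤-trans (<⇒≤ (pos<N y)) (m≤n+m N (pos z)))
  ... | i , e = i , iter-reaches i 1 (trans e (cong (pos z +_) (sym (*-identityˡ N))))

  -- A walk that never crosses the cut gives the first alternative of `Mem`, any number of crossings
  -- the second. Conversely, the second is realised by a walk crossing exactly once.
  interval⇔arc : ∀ f k y → (∃[ i ] (i ≤ k × iter σ i f ≡ y)) ⇔ Mem N (pos f , pos f + suc k) (pos y)
  interval⇔arc f k y = mk⇔ fw bw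
    where
    fw : ∃[ i ] (i ≤ k × iter σ i f ≡ y) → Mem N (pos f , pos f + suc k) (pos y)
    fw (i , i≤k , refl) with pos-iter i f
    ... | zero , eq = inj₁ (subst (pos f ≤_) (trans (sym eq) (+-identityʳ _)) (m≤m+n (pos f) i) ,
                            subst (_< pos f + suc k) (trans (sym eq) (+-identityʳ _)) (+-monoʳ-< (pos f) (s≤s i≤k)))
    ... | suc q , eq = inj₂ (≤-<-trans (+-monoʳ-≤ (pos (iter σ i f)) (m≤m+n N (q * N)))
                              (subst (_< pos f + suc k) (sym eq) (+-monoʳ-< (pos f) (s≤s i≤k))))
    bw : Mem N (pos f , pos f + suc k) (pos y) → ∃[ i ] (i ≤ k × iter σ i f ≡ y)
    bw (inj₁ (a≤ , <b)) with m≤n⇒∃[o]m+o≡n a≤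
    ... | i , e = i , ≤-pred (+-cancelˡ-< (pos f) _ _ (subst (_< pos f + suc k) (sym e) <b)) ,
                  iter-reaches i 0 (trans e (sym (+-identityʳ _)))
    bw (inj₂ <b) with m≤n⇒∃[o]m+o≡n (≤-trans (<⇒≤ (pos<N f)) (m≤n+m N (pos y)))
    ... | i , e = i , ≤-pred (+-cancelˡ-< (pos f) _ _ (subst (_< pos f + suc k) (sym e) <b)) ,
                  iter-reaches i 1 (trans e (cong (pos y +_) (sym (*-identityˡ N))))

iter-+ : ∀ {n} (σ : Permutation′ n) i j a → iter σ (i + j) a ≡ iter σ i (iter σ j a)
iter-+ σ zero j a = refl
iter-+ σ (suc i) j a = cong (σ ⟨$⟩ʳ_) (iter-+ σ i j a)

σ-injective : ∀ {n} (σ : Permutation′ n) {a b} → σ ⟨$⟩ʳ a ≡ σ ⟨$⟩ʳ b → a ≡ b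
σ-injective σ e = trans (sym (inverseˡ σ)) (trans (cong (σ ⟨$⟩ˡ_) e) (inverseˡ σ))

iter-injective : ∀ {n} (σ : Permutation′ n) i {a b} → iter σ i a ≡ iter σ i b → a ≡ b
iter-injective σ zero e = e
iter-injective σ (suc i) e = iter-injective σ i (σ-injective σ e)

iter-period : ∀ {n} (σ : Permutation′ n) p {a} → iter σ p a ≡ a → ∀ q → iter σ (q * p) a ≡ a
iter-period σ p e zero = refl
iter-period σ p {a} e (suc q) = trans (iter-+ σ p (q * p) a) (trans (cong (iter σ p) (iter-period σ p e q)) e)

-- Two of the `n + 1` iterates from exponent `0` to `n` coincide, and the smaller power cancels.
period≤n : ∀ {n} (σ : Permutation′ n) a → ∃[ p ] (0 < p × p ≤ n × iter σ p a ≡ a)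
period≤n {n} σ a with pigeonhole (n<1+n n) (λ i → iter σ (toℕ i) a)
... | i , j , i<j , e with m≤n⇒∃[o]m+o≡n (<⇒≤ i<j)
...   | p , i+p≡j = p , n≢0⇒n>0 p≢0 , ≤-trans (m≤n+m p (toℕ i)) (≤-trans (≤-reflexive i+p≡j) (≤-pred (toℕ<n j)))
                    , sym (iter-injective σ (toℕ i) (trans e (trans (cong (λ k → iter σ k a) (sym i+p≡j)) (iter-+ σ (toℕ i) p a))))
  where
  p≢0 : p ≢ 0
  p≢0 refl = <⇒≢ i<j (trans (sym (+-identityʳ (toℕ i))) i+p≡j)

-- `IsCyclic` does not bound its exponents; they are reduced modulo a period of `a`.
iter-reach< : ∀ {n} (σ : Permutation′ n) → IsCyclic σ → ∀ a b → ∃[ k ] (k < n × iter σ k a ≡ b)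
iter-reach< σ cyc a b with period≤n σ a | cyc a b
... | p , 0<p , p≤n , per | k , e = k % p , <-≤-trans (m%n<n k p) p≤n , (begin
    iter σ (k % p) a                         ≡⟨ cong (iter σ (k % p)) (iter-period σ p per (k / p)) ⟨
    iter σ (k % p) (iter σ (k / p * p) a)    ≡⟨ iter-+ σ (k % p) (k / p * p) a ⟨
    iter σ (k % p + k / p * p) a             ≡⟨ cong (λ l → iter σ l a) (m≡m%n+[m/n]*n k p) ⟨
    iter σ k a                               ≡⟨ e ⟩
    b                                        ∎)
  where
  open ≡-Reasoning
  instance
    nz : NonZero p
    nz = >-nonZero 0<p

Fin-injective⇒surjective : ∀ {n} (f : Fin n → Fin n) → (∀ {i j} → f i ≡ f j → i ≡ j) → ∀ k → ∃[ i ] f i ≡ k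
Fin-injective⇒surjective {suc n} f inj k with any? (λ i → f i ≟ k)
... | yes p = p
... | no ¬p = ⊥-elim (1+n≰n (injective⇒≤ {f = λ i → punchOut (k≢ i)} (λ e → inj (punchOut-injective (k≢ _) (k≢ _) e))))
  where
  k≢ : ∀ i → k ≢ f i
  k≢ i e = ¬p (i , sym e)

module _ {n : ℕ} (σ : Permutation′ (suc n)) (x : Fin (suc n)) (pos : Fin (suc n) → ℕ)
  (pos< : ∀ y → pos y < suc n) (e-pos : ∀ y → iter σ (pos y) (σ ⟨$⟩ʳ x) ≡ y) where

  private
    e : ℕ → Fin (suc n)
    e k = iter σ k (σ ⟨$⟩ʳ x)

    inj : ∀ {y z} → pos y ≡ pos z → y ≡ z
    inj {y} {z} eq = trans (sym (e-pos y)) (trans (cong e eq) (e-pos z))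
    fpos : Fin (suc n) → Fin (suc n)
    fpos y = fromℕ< (pos< y)
    toℕ-fpos : ∀ y → toℕ (fpos y) ≡ pos y
    toℕ-fpos y = toℕ-fromℕ< (pos< y)
    -- Since `e` recovers an element from its position, `pos` is injective, hence bijective onto the
    -- numbers below `suc n`.
    surj : ∀ {k} → k < suc n → ∃[ y ] pos y ≡ k
    surj {k} k<N with Fin-injective⇒surjective fpos
      (λ {y} {z} eq → inj (trans (sym (toℕ-fpos y)) (trans (cong toℕ eq) (toℕ-fpos z)))) (fromℕ< k<N)
    ... | y , eq = y , trans (sym (toℕ-fpos y)) (trans (cong toℕ eq) (toℕ-fromℕ< k<N))
    pos-e : ∀ {k} → k < suc n → pos (e k) ≡ k
    pos-e k<N with surj k<N
    ... | y , refl = cong pos (e-pos y)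
    -- If `e (suc k)` had a position `suc j`, cancelling one `σ` would give `e j ≡ e k`, hence
    -- `j ≡ k`; but `suc k` is out of range.
    pos-eN : ∀ {k} → suc k ≡ suc n → pos (e (suc k)) ≡ 0
    pos-eN {k} refl with pos (e (suc k)) in eq
    ... | zero = refl
    ... | suc j = ⊥-elim (<⇒≢ (pos< (e (suc k))) (trans eq (cong suc j≡k)))
      where
      j<N : suc j < suc n
      j<N = subst (_< suc n) eq (pos< (e (suc k)))
      j≡k : j ≡ k
      j≡k = trans (sym (pos-e (<⇒≤ j<N)))
              (trans (cong pos (σ-injective σ (trans (cong e (sym eq)) (e-pos (e (suc k)))))) (pos-e ≤-refl))
    step : ∀ y → pos (σ ⟨$⟩ʳ y) ≡ suc (pos y) ⊎ (suc (pos y) ≡ suc n × pos (σ ⟨$⟩ʳ y) ≡ 0)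
    step y with m≤n⇒m<n∨m≡n (pos< y)
    ... | inj₁ lt = inj₁ (trans (cong (λ z → pos (σ ⟨$⟩ʳ z)) (sym (e-pos y))) (pos-e lt))
    ... | inj₂ eq = inj₂ (eq , trans (cong (λ z → pos (σ ⟨$⟩ʳ z)) (sym (e-pos y))) (pos-eN eq))
  hittingPositions : Positions σ
  hittingPositions = record { pos = pos ; pos<N = pos< ; pos-injective = inj ; pos-surjective = surj ; pos-σ = step }
  -- Counting starts at `σ ⟨$⟩ʳ x`, which has position `0`, so the step from `x` must cross the cut.
  hittingPositions-last : pos x ≡ n
  hittingPositions-last with step x
  ... | inj₂ (eq , _) = suc-injective eq
  ... | inj₁ eq with trans (sym (pos-e (s≤s z≤n))) eq
  ...   | ()

cyclicPositions : ∀ {n} (σ : Permutation′ (suc n)) → IsCyclic σ → (x : Fin (suc n)) →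
  Σ[ P ∈ Positions σ ] Positions.pos P x ≡ n
cyclicPositions {n} σ cyc x = hittingPositions σ x pos pos< e-pos , hittingPositions-last σ x pos pos< e-pos
  where
  reach = iter-reach< σ cyc (σ ⟨$⟩ʳ x)
  pos = λ y → proj₁ (reach y)
  pos< = λ y → proj₁ (proj₂ (reach y))
  e-pos = λ y → proj₂ (proj₂ (reach y))

toℕ-punchIn-fromℕ : ∀ {n} (i : Fin n) → toℕ (punchIn (fromℕ n) i) ≡ toℕ i
toℕ-punchIn-fromℕ {suc n} zero = refl
toℕ-punchIn-fromℕ {suc n} (suc i) = cong suc (toℕ-punchIn-fromℕ i)

-- The shift by one modulo `n`: the last element goes to `zero`, the others move up in order.
rotation : ∀ n → Permutation′ n
rotation zero = Permutation.id
rotation (suc n) = insert (fromℕ n) zero Permutation.id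

rotation-toℕ : ∀ {n} (i : Fin n) →
  toℕ (rotation n ⟨$⟩ʳ i) ≡ suc (toℕ i) ⊎ (suc (toℕ i) ≡ n × toℕ (rotation n ⟨$⟩ʳ i) ≡ 0)
rotation-toℕ {suc n} i with fromℕ n ≟ i
... | yes refl = inj₂ (cong suc (toℕ-fromℕ n) , refl)
... | no ≢i = inj₁ (cong suc (trans (sym (toℕ-punchIn-fromℕ (punchOut ≢i))) (cong toℕ (punchIn-punchOut ≢i))))

-- The permutation is the rotation conjugated by the numbering.
positionsOf : ∀ {n} (pos : Fin n → ℕ) → (∀ y → pos y < n) → (∀ {y z} → pos y ≡ pos z → y ≡ z) →
  (∀ {k} → k < n → ∃[ y ] pos y ≡ k) → Σ[ σ ∈ Permutation′ n ] Positions σ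
positionsOf {n} pos pos< inj surj = π ∘ₚ (rotation n ∘ₚ flip π) , record
  { pos = pos ; pos<N = pos< ; pos-injective = inj ; pos-surjective = surj ; pos-σ = step }
  where
  el : Fin n → Fin n
  el i = proj₁ (surj (toℕ<n i))
  pos-el : ∀ i → pos (el i) ≡ toℕ i
  pos-el i = proj₂ (surj (toℕ<n i))
  π : Permutation′ n
  π = permutation (λ y → fromℕ< (pos< y)) el
    (λ i → toℕ-injective (trans (toℕ-fromℕ< _) (pos-el i)))
    (λ y → inj (trans (pos-el _) (toℕ-fromℕ< _)))
  step : ∀ y → pos (el (rotation n ⟨$⟩ʳ (fromℕ< (pos< y)))) ≡ suc (pos y) ⊎
               (suc (pos y) ≡ n × pos (el (rotation n ⟨$⟩ʳ (fromℕ< (pos< y)))) ≡ 0)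
  step y with rotation-toℕ (fromℕ< (pos< y))
  ... | inj₁ e = inj₁ (trans (pos-el _) (trans e (cong suc (toℕ-fromℕ< _))))
  ... | inj₂ (e , e₀) = inj₂ (trans (cong suc (sym (toℕ-fromℕ< _))) e , trans (pos-el _) e₀)

-- Subsets as lists, transversals as matchings.

elements : ∀ {n} → Subset n → List (Fin n)
elements X = filter (_∈? X) (allFin _)

module _ {n} (X : Subset n) where

  elements-unique : Unique (elements X)
  elements-unique = Unique.filter⁺ (_∈? X) (Unique.allFin⁺ n)

  ∈-elements : ∀ {y} → y ∈ X ⇔ y ∈ₗ elements X
  ∈-elements = mk⇔ (∈-filter⁺ (_∈? X) (∈-allFin _)) (λ y∈ → proj₂ (∈-filter⁻ (_∈? X) {xs = allFin n} y∈))

  elements-↭ : ∀ {ys} → Unique ys → (∀ {y} → y ∈ₗ ys ⇔ y ∈ X) → ys ↭ elements X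
  elements-↭ u eq = ∼bag⇒↭ (unique∧set⇒bag u elements-unique
    (mk⇔ (to ∈-elements ∘ to eq) (from eq ∘ from ∈-elements)))

Chosen : ∀ {n m} {K : Subset m} → ((k : Fin m) → k ∈ K → Fin n) → Fin n → Set
Chosen {m = m} {K} φ y = Σ[ k ∈ Fin m ] Σ[ p ∈ k ∈ K ] φ k p ≡ y

Transversal : ∀ {n m} → (Fin m → Fin n → Set) → (K : Subset m) → ((k : Fin m) → k ∈ K → Fin n) → Set
Transversal R K φ = (∀ k (p : k ∈ K) → R k (φ k p)) × (∀ k l (p : k ∈ K) (q : l ∈ K) → φ k p ≡ φ l q → k ≡ l)

module _ {I : Set} {n : ℕ} (R : I → Fin n → Set) where

  -- The entries `outside` and `inside` of `K` become the constructors `skip` and `use`.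
  transversal⇒matching : ∀ {m} (s : Fin m → I) K φ → Transversal (R ∘ s) K φ →
    ∃[ ys ] (Matching R (tabulate s) ys × Unique ys × (∀ {y} → y ∈ₗ ys ⇔ Chosen φ y))
  transversal⇒matching {zero} s [] φ _ = [] , done , [] , mk⇔ (λ ()) (λ ())
  transversal⇒matching {suc m} s (outside ∷ K) φ (r , inj)
    with transversal⇒matching (s ∘ suc) K (λ k p → φ (suc k) (there p))
           ((λ k p → r (suc k) (there p)) , λ k l p q e → Fin.suc-injective (inj (suc k) (suc l) (there p) (there q) e))
  ... | ys , M , u , eq = ys , skip M , u , mk⇔
    (λ y∈ → let k , p , e = to eq y∈ in suc k , there p , e)
    (λ { (suc k , there p , e) → from eq (k , p , e) })
  transversal⇒matching {suc m} s (inside ∷ K) φ (r , inj)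
    with transversal⇒matching (s ∘ suc) K (λ k p → φ (suc k) (there p))
           ((λ k p → r (suc k) (there p)) , λ k l p q e → Fin.suc-injective (inj (suc k) (suc l) (there p) (there q) e))
  ... | ys , M , u , eq = φ zero here ∷ ys , use (r zero here) ↭-refl M
      , All.tabulate (λ z∈ y≡z → let k , p , e = to eq z∈ in
          Fin.0≢1+n (inj zero (suc k) here (there p) (trans y≡z (sym e)))) ∷ u
      , mk⇔ (λ { (here refl) → zero , here , refl
               ; (there y∈) → let k , p , e = to eq y∈ in suc k , there p , e })
            (λ { (zero , here , refl) → here refl
               ; (suc k , there p , e) → there (from eq (k , p , e)) })

  matching⇒transversal : ∀ {m} (s : Fin m → I) {ys} → Matching R (tabulate s) ys → Unique ys →
    ∃[ K ] Σ[ φ ∈ (∀ k → k ∈ K → Fin n) ] (Transversal (R ∘ s) K φ × (∀ {y} → y ∈ₗ ys ⇔ Chosen φ y))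
  matching⇒transversal {zero} s done u = [] , (λ k ()) , ((λ k ()) , (λ k l ())) , mk⇔ (λ ()) (λ ())
  matching⇒transversal {suc m} s (skip M) u with matching⇒transversal (s ∘ suc) M u
  ... | K , φ , (r , inj) , eq = outside ∷ K , φ′ , (r′ , inj′) ,
        mk⇔ (λ y∈ → let k , p , e = to eq y∈ in suc k , there p , e) (λ { (suc k , there p , e) → from eq (k , p , e) })
    where
    φ′ : ∀ k → k ∈ outside ∷ K → Fin n
    φ′ (suc k) (there p) = φ k p
    r′ : ∀ k p → R (s k) (φ′ k p)
    r′ (suc k) (there p) = r k p
    inj′ : ∀ k l p q → φ′ k p ≡ φ′ l q → k ≡ l
    inj′ (suc k) (suc l) (there p) (there q) e = cong suc (inj k l p q e)
  matching⇒transversal {suc m} s (use {e = z} rz ↭z M) u with Unique-resp-↭ ↭z u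
  ... | z∉ ∷ u′ with matching⇒transversal (s ∘ suc) M u′
  ...   | K , φ , (r , inj) , eq = inside ∷ K , φ′ , (r′ , inj′) ,
          mk⇔ (to′ ∘ Perm.∈-resp-↭ ↭z) (Perm.∈-resp-↭ (↭-sym ↭z) ∘ from′)
    where
    φ′ : ∀ k → k ∈ inside ∷ K → Fin n
    φ′ zero _ = z
    φ′ (suc k) (there p) = φ k p
    r′ : ∀ k p → R (s k) (φ′ k p)
    r′ zero _ = rz
    r′ (suc k) (there p) = r k p
    z≢φ : ∀ k p → z ≢ φ k p
    z≢φ k p = All.lookup z∉ (from eq (k , p , refl))
    inj′ : ∀ k l p q → φ′ k p ≡ φ′ l q → k ≡ l
    inj′ zero zero _ _ _ = refl
    inj′ zero (suc l) _ (there q) e = ⊥-elim (z≢φ l q e)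
    inj′ (suc k) zero (there p) _ e = ⊥-elim (z≢φ k p (sym e))
    inj′ (suc k) (suc l) (there p) (there q) e = cong suc (inj k l p q e)
    to′ : ∀ {y} → y ∈ₗ z ∷ _ → Chosen φ′ y
    to′ (here refl) = zero , here , refl
    to′ (there y∈) = let k , p , e = to eq y∈ in suc k , there p , e
    from′ : ∀ {y} → Chosen φ′ y → y ∈ₗ z ∷ _
    from′ (zero , _ , refl) = here refl
    from′ (suc k , there p , e) = there (from eq (k , p , e))

  transversalIndep⇔matching : ∀ {m} {A : Fin m → Subset n} {s : Fin m → I} →
    (∀ j {y} → y ∈ A j ⇔ R (s j) y) → ∀ X → TransversalIndep A X ⇔ Matching R (tabulate s) (elements X)
  transversalIndep⇔matching {A = A} {s} A⇔ X = mk⇔ forward backward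
    where
    forward : TransversalIndep A X → Matching R (tabulate s) (elements X)
    forward (K , φ , φ∈ , inj , X⇔) with transversal⇒matching s K φ ((λ k p → to (A⇔ k) (φ∈ k p)) , inj)
    ... | ys , m , u , eq = Matching-resp-elements
            (elements-↭ X u (mk⇔ (from (X⇔ _) ∘ to eq) (from eq ∘ to (X⇔ _)))) m
    backward : Matching R (tabulate s) (elements X) → TransversalIndep A X
    backward m with matching⇒transversal s m (elements-unique X)
    ... | K , φ , (r , inj) , eq = K , φ , (λ k p → from (A⇔ k) (r k p)) , inj
            , λ y → mk⇔ (to eq ∘ to (∈-elements X)) (from (∈-elements X) ∘ from eq)

module _ {n : ℕ} (Y : Subset n) (x : Fin (suc n)) where

  private
    punchIn-∈ : ∀ {b z} → punchIn x z ∈ insertAt Y x b ⇔ z ∈ Y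
    punchIn-∈ {b} {z} = mk⇔
      (λ p → lookup⇒[]= z Y (trans (sym (insertAt-punchIn Y x b z)) ([]=⇒lookup p)))
      (λ p → lookup⇒[]= (punchIn x z) _ (trans (insertAt-punchIn Y x b z) ([]=⇒lookup p)))

    punched⇔ : ∀ {b y} → x ≢ y → y ∈ₗ map (punchIn x) (elements Y) ⇔ y ∈ insertAt Y x b
    punched⇔ {b} {y} x≢y = mk⇔ fw bw
      where
      fw : y ∈ₗ map (punchIn x) (elements Y) → y ∈ insertAt Y x b
      fw y∈ with ∈-map⁻ (punchIn x) y∈
      ... | z , z∈ , refl = from punchIn-∈ (from (∈-elements Y) z∈)
      bw : y ∈ insertAt Y x b → y ∈ₗ map (punchIn x) (elements Y)
      bw y∈ = subst (_∈ₗ map (punchIn x) (elements Y)) (punchIn-punchOut x≢y)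
        (∈-map⁺ (punchIn x) (to (∈-elements Y) (to (punchIn-∈ {b})
          (subst (_∈ insertAt Y x b) (sym (punchIn-punchOut x≢y)) y∈))))

    x∉ : ¬ x ∈ₗ map (punchIn x) (elements Y)
    x∉ x∈ with ∈-map⁻ (punchIn x) x∈
    ... | z , _ , e = punchInᵢ≢i x z (sym e)

    punched-unique : Unique (map (punchIn x) (elements Y))
    punched-unique = Unique.map⁺ (punchIn-injective x _ _) (elements-unique Y)

  elements-insert : x ∷ map (punchIn x) (elements Y) ↭ elements (insertAt Y x inside)
  elements-insert = elements-↭ _ (All.tabulate (λ { z∈ refl → x∉ z∈ }) ∷ punched-unique) (mk⇔ fw bw)
    where
    fw : ∀ {y} → y ∈ₗ x ∷ map (punchIn x) (elements Y) → y ∈ insertAt Y x inside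
    fw (here refl) = lookup⇒[]= x _ (insertAt-lookup Y x inside)
    fw {y} (there y∈) = to (punched⇔ (λ { refl → x∉ y∈ })) y∈
    bw : ∀ {y} → y ∈ insertAt Y x inside → y ∈ₗ x ∷ map (punchIn x) (elements Y)
    bw {y} y∈ with x ≟ y
    ... | yes refl = here refl
    ... | no x≢y = there (from (punched⇔ x≢y) y∈)

  elements-omit : map (punchIn x) (elements Y) ↭ elements (insertAt Y x outside)
  elements-omit = elements-↭ _ punched-unique (λ {y} → mk⇔ (λ y∈ → to (punched⇔ (λ { refl → x∉ y∈ })) y∈) bw)
    where
    bw : ∀ {y} → y ∈ insertAt Y x outside → y ∈ₗ map (punchIn x) (elements Y)
    bw {y} y∈ with x ≟ y
    ... | no x≢y = from (punched⇔ x≢y) y∈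
    ... | yes refl with trans (sym (insertAt-lookup Y x outside)) ([]=⇒lookup y∈)
    ...   | ()

elements-∅ : ∀ n → elements (Vec.replicate n outside) ≡ []
elements-∅ n with elements (Vec.replicate n outside) in eq
... | [] = refl
... | y ∷ _ with trans (sym (lookup-replicate y outside))
                   ([]=⇒lookup (from (∈-elements (Vec.replicate n outside)) (subst (y ∈ₗ_) (sym eq) (here refl))))
...   | ()

-- Arcs as subsets of the ground set.

does⇒ : {P : Set} (P? : Dec P) → does P? ≡ true → P
does⇒ (yes p) _ = p

Mem? : ∀ N i k → Dec (Mem N i k)
Mem? N (a , b) k = (a ≤? k ×-dec k <? b) ⊎-dec (k + N <? b)

module _ {N : ℕ} {σ : Permutation′ N} (P : Positions σ) where
  open Positions P

  arcSubset : Arc → Subset N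
  arcSubset i = Vec.tabulate (λ y → does (Mem? N i (pos y)))

  ∈-arcSubset : ∀ i {y} → y ∈ arcSubset i ⇔ Mem N i (pos y)
  ∈-arcSubset i {y} = mk⇔ fw bw
    where
    fw : y ∈ arcSubset i → Mem N i (pos y)
    fw y∈ = does⇒ (Mem? N i (pos y)) (trans (sym (lookup∘tabulate _ y)) ([]=⇒lookup y∈))
    bw : Mem N i (pos y) → y ∈ arcSubset i
    bw r = lookup⇒[]= y _ (trans (lookup∘tabulate _ y) (dec-true (Mem? N i (pos y)) r))

  arcSubset-IsInterval : ∀ i → Proper N i → IsInterval σ (arcSubset i)
  arcSubset-IsInterval i@(a , b) (a<N , a<b) with pos-surjective a<N | m≤n⇒∃[o]m+o≡n a<b
  ... | f , refl | k , refl = f , k , λ y → mk⇔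
    (from (interval⇔arc P f k y) ∘ subst (λ c → Mem N (a , c) (pos y)) (sym (+-suc (pos f) k)) ∘ to (∈-arcSubset i))
    (from (∈-arcSubset i) ∘ subst (λ c → Mem N (a , c) (pos y)) (+-suc (pos f) k) ∘ to (interval⇔arc P f k y))

  module _ {m : ℕ} {A : Fin m → Subset N} {s : Fin m → Arc} (A⇔ : ∀ j {y} → y ∈ A j ⇔ Mem N (s j) (pos y)) where

    transversalIndep⇔arcs : ∀ X → TransversalIndep A X ⇔ Matching (Mem N) (tabulate s) (map pos (elements X))
    transversalIndep⇔arcs X = mk⇔ (Matching-map⁺ ∘ to eqv) (from eqv ∘ Matching-map⁻)
      where
      eqv = transversalIndep⇔matching (λ i y → Mem N i (pos y)) {s = s} A⇔ X

    ⊆⇔Contained : ∀ j k → A j ⊆ A k ⇔ Contained N (s j) (s k)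
    ⊆⇔Contained j k = mk⇔ fw (λ c {y} y∈ → from (A⇔ k) (c (pos y) (pos<N y) (to (A⇔ j) y∈)))
      where
      fw : A j ⊆ A k → Contained N (s j) (s k)
      fw A⊆ l l<N r with pos-surjective l<N
      ... | y , refl = to (A⇔ k) (A⊆ (from (A⇔ j) r))

-- The presentation of the contraction.

module _ {n : ℕ} (M : IndepFamily (suc n)) (x : Fin (suc n))
  {σ : Permutation′ (suc n)} (P : Positions σ) (pos-x : Positions.pos P x ≡ n)
  {σ′ : Permutation′ n} (P′ : Positions σ′)
  (pos′≗ : ∀ z → Positions.pos P′ z ≡ Positions.pos P (punchIn x z))
  (is : List Arc) (s : AllPairs (Before (suc n)) is) (ps : All (Proper (suc n)) is)
  (M⇔ : ∀ X → (M X ≡ true) ⇔ Matching (Mem (suc n)) is (map (Positions.pos P) (elements X))) where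

  open Positions P using (pos)
  open Positions P′ using () renaming (pos to pos′; pos<N to pos′<n; pos-injective to pos′-injective)

  private
    merged final : List Arc
    merged = contractArcs n is
    final = shorten n merged

    merged-proper : All (Proper n) merged
    merged-proper = contractArcs-Proper is s ps

    merged-Before : AllPairs (Before n) merged
    merged-Before = contractArcs-Before is s ps

    positions : Subset n → List ℕ
    positions Y = map pos′ (elements Y)

    positions<n : ∀ Y → All (_< n) (positions Y)
    positions<n Y = All.map⁺ (All.tabulate (λ {z} _ → pos′<n z))

    positions-unique : ∀ Y → Unique (positions Y)
    positions-unique Y = Unique.map⁺ pos′-injective (elements-unique Y)

    pos-punched : ∀ ys → map pos (map (punchIn x) ys) ≡ map pos′ ys
    pos-punched ys = trans (sym (map-∘ ys)) (map-cong (λ z → sym (pos′≗ z)) ys)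

    positions-insert : ∀ Y → map pos (elements (insertAt Y x true)) ↭ n ∷ positions Y
    positions-insert Y = subst₂ (λ k ks → map pos (elements (insertAt Y x true)) ↭ k ∷ ks)
      pos-x (pos-punched (elements Y)) (Perm.map⁺ pos (↭-sym (elements-insert Y x)))

    positions-omit : ∀ Y → map pos (elements (insertAt Y x false)) ↭ positions Y
    positions-omit Y = subst (map pos (elements (insertAt Y x false)) ↭_)
      (pos-punched (elements Y)) (Perm.map⁺ pos (↭-sym (elements-omit Y x)))

    M⇔′ : ∀ X {ks} → map pos (elements X) ↭ ks → (M X ≡ true) ⇔ Matching (Mem (suc n)) is ks
    M⇔′ X p = mk⇔ (Matching-resp-elements p ∘ to (M⇔ X)) (from (M⇔ X) ∘ Matching-resp-elements (↭-sym p))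

    ⟨x⟩ : Subset (suc n)
    ⟨x⟩ = insertAt (Vec.replicate n false) x true

    -- This translates the case distinction of `contract`: `x` is a loop if and only if no arc
    -- contains `n`.
    M⟨x⟩⇔ : (M ⟨x⟩ ≡ true) ⇔ Any (λ i → Mem (suc n) i n) is
    M⟨x⟩⇔ = mk⇔ (Matching-∈ (here refl) ∘ to s⇔) (from s⇔ ∘ Matching-singleton)
      where
      s⇔ : (M ⟨x⟩ ≡ true) ⇔ Matching (Mem (suc n)) is (n ∷ [])
      s⇔ = M⇔′ ⟨x⟩ (subst (λ ys → map pos (elements ⟨x⟩) ↭ n ∷ map pos′ ys) (elements-∅ n)
        (positions-insert (Vec.replicate n false)))

    contract⇔merged : ∀ Y → (contract M x Y ≡ true) ⇔ Matching (Mem n) merged (positions Y)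
    contract⇔merged Y with M ⟨x⟩ in eq
    ... | true = mk⇔
      (contractArcs-contract is s (positions<n Y) ↭-refl ∘ to S⇔)
      (from S⇔ ∘ contractArcs-contract⁻ is s ps (positions<n Y) (to M⟨x⟩⇔ eq))
      where
      S⇔ = M⇔′ (insertAt Y x true) (positions-insert Y)
    ... | false = mk⇔
      (contractArcs-delete is avoiding ∘ to S⇔)
      (from S⇔ ∘ contractArcs-delete⁻ is avoiding)
      where
      S⇔ = M⇔′ (insertAt Y x false) (positions-omit Y)
      avoiding : All (λ i → proj₂ i ≤ n) is
      -- A proper arc starts at `n` at the latest, so it would contain `n` if it ended beyond `n`.
      avoiding = All.zipWith (λ ((a<N , _) , n∉) → ≮⇒≥ (λ n<b → n∉ (Mem-n a<N n<b)))
        (ps , All.¬Any⇒All¬ is (λ n∈ → true≢false (trans (sym (from M⟨x⟩⇔ n∈)) eq)))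
        where
        true≢false : true ≢ false
        true≢false ()

    A : Fin (length final) → Subset n
    A j = arcSubset P′ (lookup final j)

    A⇔ : ∀ j {y} → y ∈ A j ⇔ Mem n (lookup final j) (pos′ y)
    A⇔ j = ∈-arcSubset P′ (lookup final j)

    merged⇔A : ∀ Y → Matching (Mem n) merged (positions Y) ⇔ TransversalIndep A Y
    merged⇔A Y = mk⇔
      (from T⇔ ∘ subst (λ js → Matching (Mem n) js (positions Y)) (sym (tabulate-lookup final))
        ∘ shorten-matching merged-proper merged-Before (positions<n Y) (positions-unique Y))
      (shorten-matching⁻ merged ∘ subst (λ js → Matching (Mem n) js (positions Y)) (tabulate-lookup final) ∘ to T⇔)
      where
      T⇔ = transversalIndep⇔arcs P′ {s = lookup final} A⇔ Y

  contract-IsMultiPath : IsMultiPath (contract M x)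
  contract-IsMultiPath = σ′ , length final , A , Positions⇒IsCyclic P′
    , (λ j → arcSubset-IsInterval P′ _ (All.lookup (shorten-Proper merged-proper merged-Before) (∈-lookup j)))
    , (λ j k j≢k A⊆ → proj₁ (AllPairs-lookup Product.swap (shorten-Incomparable merged-proper merged-Before) j k j≢k)
        (to (⊆⇔Contained P′ {s = lookup final} A⇔ j k) A⊆))
    , λ Y → mk⇔ (to (merged⇔A Y) ∘ to (contract⇔merged Y)) (from (contract⇔merged Y) ∘ from (merged⇔A Y))

intervalArcs : ∀ {N m} {σ : Permutation′ N} (P : Positions σ) {A : Fin m → Subset N} →
  (∀ j → IsInterval σ (A j)) →
  Σ[ s ∈ (Fin m → Arc) ] ((∀ j {y} → y ∈ A j ⇔ Mem N (s j) (Positions.pos P y)) × (∀ j → Proper N (s j)))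
intervalArcs P ints = (λ j → let f , k , _ = ints j in pos f , pos f + suc k)
  , (λ j {y} → let f , k , A⇔ = ints j in
      mk⇔ (to (interval⇔arc P f k y) ∘ to (A⇔ y)) (from (A⇔ y) ∘ from (interval⇔arc P f k y)))
  , (λ j → pos<N _ , m<m+n _ (s≤s z≤n))
  where open Positions P

-- As `x` has the last position, the other elements keep their positions, which fill the range below
-- `n`.
deletePosition : ∀ {n} {σ : Permutation′ (suc n)} (P : Positions σ) x → Positions.pos P x ≡ n →
  Σ[ σ′ ∈ Permutation′ n ] Σ[ P′ ∈ Positions σ′ ] (∀ z → Positions.pos P′ z ≡ Positions.pos P (punchIn x z))
deletePosition {n} P x pos-x = proj₁ Q , proj₂ Q , λ z → refl
  where
  open Positions P
  pos′-surjective : ∀ {k} → k < n → ∃[ z ] pos (punchIn x z) ≡ k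
  pos′-surjective k<n with pos-surjective (m≤n⇒m≤1+n k<n)
  ... | y , refl = punchOut x≢y , cong pos (punchIn-punchOut x≢y)
    where
    x≢y : x ≢ y
    x≢y refl = <⇒≢ k<n pos-x
  Q : Σ[ σ ∈ Permutation′ n ] Positions σ
  Q = positionsOf (λ z → pos (punchIn x z))
    (λ z → ≤∧≢⇒< (≤-pred (pos<N (punchIn x z))) (λ e → punchInᵢ≢i x z (pos-injective (trans e (sym pos-x)))))
    (λ e → punchIn-injective x _ _ (pos-injective e)) pos′-surjective

module _ {n m : ℕ} (M : IndepFamily (suc n)) (x : Fin (suc n)) {σ : Permutation′ (suc n)}
  {A : Fin m → Subset (suc n)} (anti : IsAntichain A) (M⇔ : ∀ X → (M X ≡ true) ⇔ TransversalIndep A X) where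

  contract-from-arcs : (Q : Σ[ P ∈ Positions σ ] Positions.pos P x ≡ n) → let P = proj₁ Q in
    Σ[ s ∈ (Fin m → Arc) ] ((∀ j {y} → y ∈ A j ⇔ Mem (suc n) (s j) (Positions.pos P y)) × (∀ j → Proper (suc n) (s j))) →
    Σ[ σ′ ∈ Permutation′ n ] Σ[ P′ ∈ Positions σ′ ] (∀ z → Positions.pos P′ z ≡ Positions.pos P (punchIn x z)) →
    IsMultiPath (contract M x)
  contract-from-arcs (P , pos-x) (arc , A⇔ , proper) (σ′ , P′ , pos′≗) =
    contract-IsMultiPath M x P pos-x P′ pos′≗
      (sort byStart arcs) (sort-Before arcs proper′ (AllPairs.tabulate⁺ incomparable))
      (Perm.All-resp-↭ (↭-sym sorted↭) proper′)
      λ X → mk⇔ (Matching-resp-↭ (↭-sym sorted↭) ∘ to (T⇔ X) ∘ to (M⇔ X))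
                (from (M⇔ X) ∘ from (T⇔ X) ∘ Matching-resp-↭ sorted↭)
    where
    arcs : List Arc
    arcs = tabulate arc
    sorted↭ : sort byStart arcs ↭ arcs
    sorted↭ = sort-↭ byStart arcs
    proper′ : All (Proper (suc n)) arcs
    proper′ = All.tabulate⁺ proper
    incomparable : ∀ {j k} → j ≢ k → Incomparable (suc n) (arc j) (arc k)
    incomparable {j} {k} j≢k = anti j k j≢k ∘ from (⊆⇔Contained P {s = arc} A⇔ j k)
                             , anti k j (j≢k ∘ sym) ∘ from (⊆⇔Contained P {s = arc} A⇔ k j)
    T⇔ = transversalIndep⇔arcs P {s = arc} A⇔

theorem3p5 : ∀ (n : ℕ) (M : IndepFamily (suc n)) (x : Fin (suc n)) →
    IsMultiPath M → IsMultiPath (contract M x)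
theorem3p5 n M x (σ , m , A , cyc , ints , anti , M⇔) =
  contract-from-arcs M x anti M⇔ Q (intervalArcs (proj₁ Q) ints) (deletePosition (proj₁ Q) x (proj₂ Q))
  where
  Q : Σ[ P ∈ Positions σ ] Positions.pos P x ≡ n
  Q = cyclicPositions σ cyc x
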